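{- For all integers $i,j\ge 0$ and $k,\ell,n\in\mathbb{N}$ with $i+j=k$, there exists a bipartite graph $G$ with pathwidth at most $k+1$ such that for any graph $H$ and path $P$, if $G$ is isomorphic to a subgraph of $H\boxtimes P\boxtimes K_\ell$, then $P_n+K_{i,j}$ is a $2$-small minor of $H$.
   Context: Graphs are finite and simple; $\mathbb{N}=\{1,2,\dots\}$. $P_n$ is the path on $n$ vertices, $K_\ell$ the complete graph on $\ell$ vertices, and $K_{i,j}$ the complete bipartite graph with parts of sizes $i$ and $j$ (so $K_{i,0}$ is edgeless on $i$ vertices). For graphs $A,B$, the complete join $A+B$ is the disjoint union of $A$ and $B$ together with all edges between $V(A)$ and $V(B)$. The strong product $A\boxtimes B$ has vertex set $V(A)\times V(B)$ with distinct $(v,w),(v',w')$ adjacent if ($v=v'$ or $vv'\in E(A)$) and ($w=w'$ or $ww'\in E(B)$). A model of $F$ in $H$ is a map $\mu$ assigning to each $v\in V(F)$ a connected subgraph $\mu(v)$ of $H$, pairwise vertex-disjoint, such that $\mu(v)$ and $\mu(w)$ are joined by an edge of $H$ whenever $vw\in E(F)$. $F$ is an $s$-small minor of $H$ if there is a model $\mu$ of $F$ in $H$ with $|V(\mu(v))|\le s$ for all $v$. -}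

module Defs where

open import Data.Nat as ℕ using (ℕ; zero; suc; _+_; _*_; _≤_)
open import Data.Fin as Fin using (Fin; toℕ; splitAt; remQuot)
open import Data.Fin.Subset using (Subset; _∈_; ∣_∣)
open import Data.Bool using (Bool; true; false; not; _∧_; _∨_)
open import Data.Bool.Properties using (∨-comm)
open import Data.Product using (Σ; ∃; ∃-syntax; _×_; _,_)
open import Data.Sum using (_⊎_; inj₁; inj₂)
open import Data.Empty using (⊥-elim)
open import Relation.Nullary using (¬_; yes; no)
open import Relation.Nullary.Decidable using (⌊_⌋)
open import Relation.Binary.PropositionalEquality using (_≡_; _≢_; refl; sym)
open import Function.Definitions using (Injective)

record Graph : Set where
  field
    size    : ℕ
    adj     : Fin size → Fin size → Bool
    adj-sym : ∀ u v → adj u v ≡ adj v u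
    adj-irr : ∀ v → adj v v ≡ false
open Graph public

Edge : (G : Graph) → Fin (size G) → Fin (size G) → Set
Edge G u v = adj G u v ≡ true

eqF : ∀ {n} → Fin n → Fin n → Bool
eqF x y = ⌊ x Fin.≟ y ⌋

eqF-refl : ∀ {n} (x : Fin n) → eqF x x ≡ true
eqF-refl x with x Fin.≟ x
... | yes _ = refl
... | no ¬p = ⊥-elim (¬p refl)

eqF-sym : ∀ {n} (x y : Fin n) → eqF x y ≡ eqF y x
eqF-sym x y with x Fin.≟ y | y Fin.≟ x
... | yes _ | yes _ = refl
... | no _  | no _  = refl
... | yes p | no ¬q = ⊥-elim (¬q (sym p))
... | no ¬p | yes q = ⊥-elim (¬p (sym q))

succ≡ : ℕ → ℕ → Bool
succ≡ a b = ⌊ suc a ℕ.≟ b ⌋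

succ≡-irr : ∀ a → succ≡ a a ≡ false
succ≡-irr a with suc a ℕ.≟ a
... | yes p = ⊥-elim (lem a p)
  where
    lem : ∀ a → suc a ≢ a
    lem zero ()
    lem (suc a) e = lem a (Data.Nat.Properties.suc-injective e)
      where import Data.Nat.Properties
... | no _ = refl

Path : ℕ → Graph
Path m = record
  { size    = m
  ; adj     = λ i j → succ≡ (toℕ i) (toℕ j) ∨ succ≡ (toℕ j) (toℕ i)
  ; adj-sym = λ i j → ∨-comm (succ≡ (toℕ i) (toℕ j)) (succ≡ (toℕ j) (toℕ i))
  ; adj-irr = λ i → irr (toℕ i)
  }
  where
    irr : ∀ a → succ≡ a a ∨ succ≡ a a ≡ false
    irr a rewrite succ≡-irr a = refl

K : ℕ → Graph
K ℓ = record
  { size    = ℓ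
  ; adj     = λ i j → not (eqF i j)
  ; adj-sym = λ i j → cong′ (eqF-sym i j)
  ; adj-irr = λ i → cong′ (eqF-refl i)
  }
  where
    cong′ : ∀ {a b : Bool} → a ≡ b → not a ≡ not b
    cong′ refl = refl

inFirst : (i : ℕ) {j : ℕ} → Fin (i + j) → Bool
inFirst i v with splitAt i v
... | inj₁ _ = true
... | inj₂ _ = false

diffB : Bool → Bool → Bool
diffB true  true  = false
diffB true  false = true
diffB false true  = true
diffB false false = false

diffB-sym : ∀ a b → diffB a b ≡ diffB b a
diffB-sym true  true  = refl
diffB-sym true  false = refl
diffB-sym false true  = refl
diffB-sym false false = refl

diffB-irr : ∀ a → diffB a a ≡ false
diffB-irr true  = refl
diffB-irr false = refl

Kbip : ℕ → ℕ → Graph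
Kbip i j = record
  { size    = i + j
  ; adj     = λ u v → diffB (inFirst i u) (inFirst i v)
  ; adj-sym = λ u v → diffB-sym (inFirst i u) (inFirst i v)
  ; adj-irr = λ u → diffB-irr (inFirst i u)
  }

joinAdj : ∀ {a b} → (Fin a → Fin a → Bool) → (Fin b → Fin b → Bool)
        → Fin a ⊎ Fin b → Fin a ⊎ Fin b → Bool
joinAdj fA fB (inj₁ x) (inj₁ y) = fA x y
joinAdj fA fB (inj₁ x) (inj₂ y) = true
joinAdj fA fB (inj₂ x) (inj₁ y) = true
joinAdj fA fB (inj₂ x) (inj₂ y) = fB x y

_⊕_ : Graph → Graph → Graph
A ⊕ B = record
  { size    = size A + size B
  ; adj     = λ u v → joinAdj (adj A) (adj B) (splitAt (size A) u) (splitAt (size A) v)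
  ; adj-sym = λ u v → js (splitAt (size A) u) (splitAt (size A) v)
  ; adj-irr = λ u → ji (splitAt (size A) u)
  }
  where
    js : ∀ p q → joinAdj (adj A) (adj B) p q ≡ joinAdj (adj A) (adj B) q p
    js (inj₁ x) (inj₁ y) = adj-sym A x y
    js (inj₁ x) (inj₂ y) = refl
    js (inj₂ x) (inj₁ y) = refl
    js (inj₂ x) (inj₂ y) = adj-sym B x y
    ji : ∀ p → joinAdj (adj A) (adj B) p p ≡ false
    ji (inj₁ x) = adj-irr A x
    ji (inj₂ x) = adj-irr B x

_⊠_ : Graph → Graph → Graph
A ⊠ B = record
  { size    = size A * size B
  ; adj     = sadj
  ; adj-sym = ssym
  ; adj-irr = sirr
  }
  where
    pairAdj : Fin (size A) × Fin (size B) → Fin (size A) × Fin (size B) → Bool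
    pairAdj (x , y) (x′ , y′) = (eqF x x′ ∨ adj A x x′) ∧ (eqF y y′ ∨ adj B y y′)
    pairSym : ∀ p q → pairAdj p q ≡ pairAdj q p
    pairSym (x , y) (x′ , y′)
      rewrite eqF-sym x x′ | adj-sym A x x′ | eqF-sym y y′ | adj-sym B y y′ = refl
    sadj : Fin (size A * size B) → Fin (size A * size B) → Bool
    sadj u v = not (eqF u v) ∧ pairAdj (remQuot (size B) u) (remQuot (size B) v)
    ssym : ∀ u v → sadj u v ≡ sadj v u
    ssym u v rewrite eqF-sym u v | pairSym (remQuot (size B) u) (remQuot (size B) v) = refl
    sirr : ∀ u → sadj u u ≡ false
    sirr u rewrite eqF-refl u = refl

Bipartite : Graph → Set
Bipartite G = Σ (Fin (size G) → Bool) λ c → ∀ u v → Edge G u v → c u ≢ c v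

record PathDecomposition (G : Graph) (w : ℕ) : Set where
  field
    len      : ℕ
    bag      : Fin len → Subset (size G)
    covers-v : ∀ v → ∃[ a ] v ∈ bag a
    covers-e : ∀ u v → Edge G u v → ∃[ a ] (u ∈ bag a × v ∈ bag a)
    interval : ∀ v (a b c : Fin len) → a Fin.≤ b → b Fin.≤ c
               → v ∈ bag a → v ∈ bag c → v ∈ bag b
    width    : ∀ a → ∣ bag a ∣ ≤ suc w

PathwidthAtMost : Graph → ℕ → Set
PathwidthAtMost G w = PathDecomposition G w

SubgraphOf : Graph → Graph → Set
SubgraphOf G X =
  Σ (Fin (size G) → Fin (size X)) λ f →
    Injective _≡_ _≡_ f × (∀ u v → Edge G u v → Edge X (f u) (f v))

data WalkIn (H : Graph) (S : Subset (size H)) : Fin (size H) → Fin (size H) → Set where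
  stop : ∀ {x} → x ∈ S → WalkIn H S x x
  step : ∀ {x y z} → x ∈ S → Edge H x y → WalkIn H S y z → WalkIn H S x z

ConnectedIn : (H : Graph) → Subset (size H) → Set
ConnectedIn H S = (∃[ x ] x ∈ S) × (∀ x y → x ∈ S → y ∈ S → WalkIn H S x y)

record SmallModel (s : ℕ) (F H : Graph) : Set where
  field
    μ         : Fin (size F) → Subset (size H)
    connected : ∀ v → ConnectedIn H (μ v)
    disjoint  : ∀ v w → v ≢ w → ∀ x → x ∈ μ v → ¬ (x ∈ μ w)
    edges     : ∀ v w → Edge F v w → ∃[ x ] ∃[ y ] (x ∈ μ v × y ∈ μ w × Edge H x y)
    small     : ∀ v → ∣ μ v ∣ ≤ s

SmallMinor : ℕ → Graph → Graph → Set
SmallMinor s F H = SmallModel s F H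

module Submission where

-- Start from a long 2-coloured path and k times take many disjoint copies and add one vertex (an
-- apex) adjacent to everything of the opposite colour; each apex adds 1 to the pathwidth. All vertices
-- lie within distance 2 of the last apex, so in H ⊠ P ⊠ K_ℓ they occupy at most 5 layers and every
-- vertex of H is the projection of at most 5ℓ of them. Hence some copy avoids the projection of its
-- apex; choosing such copies from the outside in gives k distinct apices in H and a path of G that
-- projects to a walk avoiding them and visiting every vertex at most 5ℓ times. If the walk is long
-- enough, it contains a long path in H each of whose edges comes from an edge of G; as the
-- ends of such an edge have different colours, consecutive vertices of the path taken two by two
-- are adjacent to all the apices.

open import Defs
open import Data.Nat as ℕ using (ℕ; zero; suc; _+_; _*_; _∸_; _≤_; _<_; z≤n; s≤s)
open import Data.Nat.Properties
open import Data.Nat.DivMod using (_mod_; m<n⇒m%n≡m; m%n<n)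
open import Data.Fin as Fin using (Fin; zero; suc; toℕ; fromℕ<; splitAt; join; _↑ˡ_; _↑ʳ_; combine; inject₁; remQuot)
open import Data.Fin.Properties as Finₚ using (toℕ-injective; toℕ-↑ˡ; toℕ-↑ʳ; splitAt-↑ˡ; splitAt-↑ʳ; join-splitAt)
open import Data.Fin.Subset using (Subset; _∈_; ∣_∣; ⊥; ⁅_⁆; _∪_)
open import Data.Fin.Subset.Properties using (∉⊥; ∣⊥∣≡0; ∣⁅x⁆∣≡1; x∈⁅x⁆; x∈⁅y⁆⇒x≡y; x∈p∪q⁺; x∈p∪q⁻)
open import Data.Vec using ([]; _∷_; _++_; here; there)
open import Data.Bool using (Bool; true; false; not; _∧_; _∨_)
open import Data.Bool.Properties using (∧-conicalˡ; ∧-conicalʳ)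
open import Data.Product using (Σ; ∃-syntax; _×_; _,_; proj₁; proj₂)
open import Data.Sum as Sum using (_⊎_; inj₁; inj₂; [_,_]′)
open import Data.Empty using (⊥-elim)
open import Function using (_∘_; id)
open import Function.Definitions using (Injective)
open import Relation.Nullary using (¬_; Dec; yes; no)
open import Relation.Unary using (Decidable)
open import Relation.Binary.Definitions using (DecidableEquality; tri<; tri≈; tri>)
open import Relation.Binary.PropositionalEquality using (_≡_; _≢_; refl; sym; trans; cong; cong₂; subst; subst₂)

-- Finite subsets: pairs and concatenation.

∣p∪q∣≤∣p∣+∣q∣ : ∀ {n} (p q : Subset n) → ∣ p ∪ q ∣ ≤ ∣ p ∣ + ∣ q ∣
∣p∪q∣≤∣p∣+∣q∣ [] [] = z≤n
∣p∪q∣≤∣p∣+∣q∣ (true ∷ p) (true ∷ q) =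
  s≤s (≤-trans (∣p∪q∣≤∣p∣+∣q∣ p q) (+-monoʳ-≤ ∣ p ∣ (n≤1+n ∣ q ∣)))
∣p∪q∣≤∣p∣+∣q∣ (true ∷ p) (false ∷ q) = s≤s (∣p∪q∣≤∣p∣+∣q∣ p q)
∣p∪q∣≤∣p∣+∣q∣ (false ∷ p) (true ∷ q) =
  subst (suc ∣ p ∪ q ∣ ≤_) (sym (+-suc ∣ p ∣ ∣ q ∣)) (s≤s (∣p∪q∣≤∣p∣+∣q∣ p q))
∣p∪q∣≤∣p∣+∣q∣ (false ∷ p) (false ∷ q) = ∣p∪q∣≤∣p∣+∣q∣ p q

∣⁅x⁆∪⁅y⁆∣≤2 : ∀ {n} (x y : Fin n) → ∣ ⁅ x ⁆ ∪ ⁅ y ⁆ ∣ ≤ 2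
∣⁅x⁆∪⁅y⁆∣≤2 x y =
  subst (∣ ⁅ x ⁆ ∪ ⁅ y ⁆ ∣ ≤_) (cong₂ _+_ (∣⁅x⁆∣≡1 x) (∣⁅x⁆∣≡1 y)) (∣p∪q∣≤∣p∣+∣q∣ ⁅ x ⁆ ⁅ y ⁆)

x∈⁅y⁆∪⁅z⁆⁻ : ∀ {n} {x : Fin n} y z → x ∈ ⁅ y ⁆ ∪ ⁅ z ⁆ → x ≡ y ⊎ x ≡ z
x∈⁅y⁆∪⁅z⁆⁻ y z m with x∈p∪q⁻ ⁅ y ⁆ ⁅ z ⁆ m
... | inj₁ m′ = inj₁ (x∈⁅y⁆⇒x≡y y m′)
... | inj₂ m′ = inj₂ (x∈⁅y⁆⇒x≡y z m′)

x∈⁅x⁆∪⁅y⁆ : ∀ {n} (x y : Fin n) → x ∈ ⁅ x ⁆ ∪ ⁅ y ⁆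
x∈⁅x⁆∪⁅y⁆ x y = x∈p∪q⁺ (inj₁ (x∈⁅x⁆ x))

y∈⁅x⁆∪⁅y⁆ : ∀ {n} (x y : Fin n) → y ∈ ⁅ x ⁆ ∪ ⁅ y ⁆
y∈⁅x⁆∪⁅y⁆ x y = x∈p∪q⁺ {p = ⁅ x ⁆} (inj₂ (x∈⁅x⁆ y))

∣p++q∣≡∣p∣+∣q∣ : ∀ {m n} (p : Subset m) (q : Subset n) → ∣ p ++ q ∣ ≡ ∣ p ∣ + ∣ q ∣
∣p++q∣≡∣p∣+∣q∣ []          q = refl
∣p++q∣≡∣p∣+∣q∣ (true ∷ p)  q = cong suc (∣p++q∣≡∣p∣+∣q∣ p q)
∣p++q∣≡∣p∣+∣q∣ (false ∷ p) q = ∣p++q∣≡∣p∣+∣q∣ p q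

∈-++ˡ⁺ : ∀ {m n} {x : Fin m} {p : Subset m} {q : Subset n} → x ∈ p → (x ↑ˡ n) ∈ p ++ q
∈-++ˡ⁺ here      = here
∈-++ˡ⁺ (there m) = there (∈-++ˡ⁺ m)

∈-++ʳ⁺ : ∀ {m n} {x : Fin n} (p : Subset m) {q : Subset n} → x ∈ q → (m ↑ʳ x) ∈ p ++ q
∈-++ʳ⁺ []      x∈q = x∈q
∈-++ʳ⁺ (_ ∷ p) x∈q = there (∈-++ʳ⁺ p x∈q)

∈-++ˡ⁻ : ∀ {m n} {x : Fin m} {p : Subset m} {q : Subset n} → (x ↑ˡ n) ∈ p ++ q → x ∈ p
∈-++ˡ⁻ {x = zero}  {_ ∷ _} here      = here
∈-++ˡ⁻ {x = suc x} {_ ∷ _} (there m) = there (∈-++ˡ⁻ m)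

∈-++ʳ⁻ : ∀ {m n} {x : Fin n} (p : Subset m) {q : Subset n} → (m ↑ʳ x) ∈ p ++ q → x ∈ q
∈-++ʳ⁻ []      m         = m
∈-++ʳ⁻ (_ ∷ p) (there m) = ∈-++ʳ⁻ p m

data SplitView (m n : ℕ) : Fin (m + n) → Set where
  left  : ∀ x → SplitView m n (x ↑ˡ n)
  right : ∀ y → SplitView m n (m ↑ʳ y)

splitView : ∀ m n i → SplitView m n i
splitView m n i with splitAt m i in eq
... | inj₁ x = subst (SplitView m n) (Finₚ.splitAt⁻¹-↑ˡ eq) (left x)
... | inj₂ y = subst (SplitView m n) (Finₚ.splitAt⁻¹-↑ʳ eq) (right y)

-- Two-coloured graphs, cones, disjoint copies and embeddings.

diffB⇒≢ : ∀ {a b} → diffB a b ≡ true → a ≢ b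
diffB⇒≢ {a} d refl with () ← trans (sym d) (diffB-irr a)

-- With only two colours, any colour differs from one of two distinct ones. Applied to the ends of
-- an edge, this shows that an apex of either colour is adjacent to one of them.
diffB-choice : ∀ {a b} → diffB a b ≡ true → ∀ c → diffB c a ≡ true ⊎ diffB c b ≡ true
diffB-choice {true}  {false} _ true  = inj₂ refl
diffB-choice {true}  {false} _ false = inj₁ refl
diffB-choice {false} {true}  _ true  = inj₁ refl
diffB-choice {false} {true}  _ false = inj₂ refl

-- Properness is phrased by `diffB` because the same Boolean gives the adjacency of a cone apex and
-- that of `Kbip`, so a colour difference can serve directly as an edge.
record ColouredGraph : Set where
  field
    graph  : Graph
    colour : Fin (size graph) → Bool
    proper : ∀ u v → Edge graph u v → diffB (colour u) (colour v) ≡ true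
open ColouredGraph

V : ColouredGraph → Set
V G = Fin (size (graph G))

E : (G : ColouredGraph) → V G → V G → Set
E G = Edge (graph G)

E-sym : ∀ (G : Graph) {u v} → Edge G u v → Edge G v u
E-sym G {u} {v} e = trans (adj-sym G v u) e

-- Joining the apex to the opposite colour only keeps the graph bipartite. The apex then misses its
-- own colour class, which is why the minor needs branch sets of two vertices on the path.
cone : Bool → ColouredGraph → ColouredGraph
cone b G = record
  { graph = record
      { size    = suc (size (graph G))
      ; adj     = coneAdj
      ; adj-sym = coneSym
      ; adj-irr = coneIrr
      }
  ; colour = coneColour
  ; proper = coneProper
  }
  where
    coneColour : Fin (suc (size (graph G))) → Bool
    coneColour zero    = b
    coneColour (suc v) = colour G v
    coneAdj : Fin (suc (size (graph G))) → Fin (suc (size (graph G))) → Bool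
    coneAdj zero    zero    = false
    coneAdj zero    (suc v) = diffB b (colour G v)
    coneAdj (suc u) zero    = diffB b (colour G u)
    coneAdj (suc u) (suc v) = adj (graph G) u v
    coneSym : ∀ u v → coneAdj u v ≡ coneAdj v u
    coneSym zero    zero    = refl
    coneSym zero    (suc v) = refl
    coneSym (suc u) zero    = refl
    coneSym (suc u) (suc v) = adj-sym (graph G) u v
    coneIrr : ∀ v → coneAdj v v ≡ false
    coneIrr zero    = refl
    coneIrr (suc v) = adj-irr (graph G) v
    coneProper : ∀ u v → coneAdj u v ≡ true → diffB (coneColour u) (coneColour v) ≡ true
    coneProper zero    (suc v) e = e
    coneProper (suc u) zero    e = trans (diffB-sym (colour G u) b) e
    coneProper (suc u) (suc v) e = proper G u v e

module _ (G G′ : ColouredGraph) where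
  private
    sumAdj : V G ⊎ V G′ → V G ⊎ V G′ → Bool
    sumAdj (inj₁ x) (inj₁ y) = adj (graph G) x y
    sumAdj (inj₂ x) (inj₂ y) = adj (graph G′) x y
    sumAdj _        _        = false
    sumSym : ∀ p q → sumAdj p q ≡ sumAdj q p
    sumSym (inj₁ x) (inj₁ y) = adj-sym (graph G) x y
    sumSym (inj₁ x) (inj₂ y) = refl
    sumSym (inj₂ x) (inj₁ y) = refl
    sumSym (inj₂ x) (inj₂ y) = adj-sym (graph G′) x y
    sumIrr : ∀ p → sumAdj p p ≡ false
    sumIrr (inj₁ x) = adj-irr (graph G) x
    sumIrr (inj₂ x) = adj-irr (graph G′) x
    sumProper : ∀ p q → sumAdj p q ≡ true →
      diffB ([ colour G , colour G′ ]′ p) ([ colour G , colour G′ ]′ q) ≡ true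
    sumProper (inj₁ x) (inj₁ y) e = proper G x y e
    sumProper (inj₂ x) (inj₂ y) e = proper G′ x y e
    split : Fin (size (graph G) + size (graph G′)) → V G ⊎ V G′
    split = splitAt (size (graph G))

  _⊍_ : ColouredGraph
  _⊍_ = record
    { graph = record
        { size    = size (graph G) + size (graph G′)
        ; adj     = λ u v → sumAdj (split u) (split v)
        ; adj-sym = λ u v → sumSym (split u) (split v)
        ; adj-irr = λ u → sumIrr (split u)
        }
    ; colour = [ colour G , colour G′ ]′ ∘ split
    ; proper = λ u v → sumProper (split u) (split v)
    }

empty : ColouredGraph
empty = record
  { graph  = record { size = 0 ; adj = λ () ; adj-sym = λ () ; adj-irr = λ () }
  ; colour = λ ()
  ; proper = λ ()
  }

copies : ℕ → ColouredGraph → ColouredGraph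
copies zero    G = empty
copies (suc m) G = G ⊍ copies m G

-- Colours must be preserved because they decide which vertices an apex added later is adjacent to.
record Embedding (G G′ : ColouredGraph) : Set where
  field
    to        : V G → V G′
    injective : Injective _≡_ _≡_ to
    edge      : ∀ {u v} → E G u v → E G′ (to u) (to v)
    colour≡   : ∀ u → colour G′ (to u) ≡ colour G u
open Embedding

⊍-left : ∀ G G′ → Embedding G (G ⊍ G′)
⊍-left G G′ = record
  { to        = _↑ˡ size (graph G′)
  ; injective = λ {u} {v} → Finₚ.↑ˡ-injective (size (graph G′)) u v
  ; edge      = λ {u} {v} → edge′ u v
  ; colour≡   = λ u → cong [ colour G , colour G′ ]′ (splitAt-↑ˡ (size (graph G)) u (size (graph G′)))
  }
  where
    edge′ : ∀ u v → E G u v → E (G ⊍ G′) (u ↑ˡ _) (v ↑ˡ _)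
    edge′ u v e
      rewrite splitAt-↑ˡ (size (graph G)) u (size (graph G′))
            | splitAt-↑ˡ (size (graph G)) v (size (graph G′)) = e

⊍-right : ∀ G G′ → Embedding G′ (G ⊍ G′)
⊍-right G G′ = record
  { to        = size (graph G) ↑ʳ_
  ; injective = λ {u} {v} → Finₚ.↑ʳ-injective (size (graph G)) u v
  ; edge      = λ {u} {v} → edge′ u v
  ; colour≡   = λ u → cong [ colour G , colour G′ ]′ (splitAt-↑ʳ (size (graph G)) (size (graph G′)) u)
  }
  where
    edge′ : ∀ u v → E G′ u v → E (G ⊍ G′) (size (graph G) ↑ʳ u) (size (graph G) ↑ʳ v)
    edge′ u v e
      rewrite splitAt-↑ʳ (size (graph G)) (size (graph G′)) u
            | splitAt-↑ʳ (size (graph G)) (size (graph G′)) v = e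

infixr 9 _∘ₑ_
_∘ₑ_ : ∀ {G G′ G″} → Embedding G′ G″ → Embedding G G′ → Embedding G G″
f ∘ₑ g = record
  { to        = to f ∘ to g
  ; injective = injective g ∘ injective f
  ; edge      = edge f ∘ edge g
  ; colour≡   = λ u → trans (colour≡ f (to g u)) (colour≡ g u)
  }

cone-base : ∀ b G → Embedding G (cone b G)
cone-base b G = record
  { to = suc ; injective = Finₚ.suc-injective ; edge = λ e → e ; colour≡ = λ u → refl }

copy : ∀ {m} G → Fin m → Embedding G (copies m G)
copy {suc m} G zero    = ⊍-left G (copies m G)
copy {suc m} G (suc s) = ⊍-right G (copies m G) ∘ₑ copy G s

↑ˡ≢↑ʳ : ∀ {m n} (x : Fin m) (y : Fin n) → x ↑ˡ n ≢ m ↑ʳ y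
↑ˡ≢↑ʳ {m} {n} x y eq
  with () ← trans (sym (splitAt-↑ˡ m x n)) (trans (cong (splitAt m) eq) (splitAt-↑ʳ m n y))

copy-disjoint : ∀ {m} G (s t : Fin m) {u v} → to (copy G s) u ≡ to (copy G t) v → s ≡ t
copy-disjoint G zero    zero    eq = refl
copy-disjoint G zero    (suc t) eq = ⊥-elim (↑ˡ≢↑ʳ _ _ eq)
copy-disjoint G (suc s) zero    eq = ⊥-elim (↑ˡ≢↑ʳ _ _ (sym eq))
copy-disjoint G (suc s) (suc t) eq =
  cong suc (copy-disjoint G s t (Finₚ.↑ʳ-injective (size (graph G)) _ _ eq))

-- Path decompositions of cones and disjoint unions.

open PathDecomposition

-- The apex is added to every bag, which costs one.
cone-pathwidth : ∀ {w} b G → PathwidthAtMost (graph G) w → PathwidthAtMost (graph (cone b G)) (suc w)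
cone-pathwidth {w} b G D = record
  { len      = suc (len D)
  ; bag      = bag′
  ; covers-v = λ { zero → zero , here ; (suc v) → let a , m = covers-v D v in suc a , there m }
  ; covers-e = cov
  ; interval = int
  ; width    = λ { zero    → s≤s (≤-trans (≤-reflexive (∣⊥∣≡0 (size (graph G)))) z≤n)
                 ; (suc a) → s≤s (width D a) }
  }
  where
    -- The bag holding only the apex is there for the case that D has no bags.
    bag′ : Fin (suc (len D)) → Subset (suc (size (graph G)))
    bag′ zero    = true ∷ ⊥
    bag′ (suc a) = true ∷ bag D a
    apex∈ : ∀ a → zero ∈ bag′ a
    apex∈ zero    = here
    apex∈ (suc a) = here
    cov : ∀ u v → E (cone b G) u v → ∃[ a ] (u ∈ bag′ a × v ∈ bag′ a)
    cov zero    (suc v) e = let a , m = covers-v D v in suc a , here , there m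
    cov (suc u) zero    e = let a , m = covers-v D u in suc a , there m , here
    cov (suc u) (suc v) e = let a , m , n = covers-e D u v e in suc a , there m , there n
    int : ∀ v (a b c : Fin (suc (len D))) → a Fin.≤ b → b Fin.≤ c → v ∈ bag′ a → v ∈ bag′ c → v ∈ bag′ b
    int zero    a b c _ _ _ _ = apex∈ b
    int (suc v) zero    b c _ _ (there m) _ = ⊥-elim (∉⊥ m)
    int (suc v) (suc a) (suc b) (suc c) (s≤s p) (s≤s q) (there m) (there n) =
      there (interval D v a b c p q m n)

-- The two sequences of bags are placed one after the other, each bag padded with `⊥` on the other
-- side. No vertex lies in bags of both sequences, so the bags of a vertex stay consecutive.
⊍-pathwidth : ∀ {w} G G′ → PathwidthAtMost (graph G) w → PathwidthAtMost (graph G′) w →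
  PathwidthAtMost (graph (G ⊍ G′)) w
⊍-pathwidth {w} G G′ D D′ = record
  { len      = len D + len D′
  ; bag      = bag′
  ; covers-v = covV
  ; covers-e = covE
  ; interval = int
  ; width    = wid
  }
  where
    k = size (graph G)
    k′ = size (graph G′)
    bagS : Fin (len D) ⊎ Fin (len D′) → Subset (k + k′)
    bagS (inj₁ a) = bag D a ++ ⊥
    bagS (inj₂ a) = ⊥ {n = k} ++ bag D′ a
    bag′ : Fin (len D + len D′) → Subset (k + k′)
    bag′ a = bagS (splitAt (len D) a)
    bagˡ : ∀ a → bag′ (a ↑ˡ len D′) ≡ bag D a ++ ⊥
    bagˡ a = cong bagS (splitAt-↑ˡ (len D) a (len D′))
    bagʳ : ∀ a → bag′ (len D ↑ʳ a) ≡ ⊥ {n = k} ++ bag D′ a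
    bagʳ a = cong bagS (splitAt-↑ʳ (len D) (len D′) a)
    ll⁺ : ∀ {x a} → x ∈ bag D a → (x ↑ˡ k′) ∈ bag′ (a ↑ˡ len D′)
    ll⁺ {x} {a} m = subst (x ↑ˡ k′ ∈_) (sym (bagˡ a)) (∈-++ˡ⁺ m)
    rr⁺ : ∀ {x a} → x ∈ bag D′ a → (k ↑ʳ x) ∈ bag′ (len D ↑ʳ a)
    rr⁺ {x} {a} m = subst (k ↑ʳ x ∈_) (sym (bagʳ a)) (∈-++ʳ⁺ ⊥ m)
    ll⁻ : ∀ {x} a → (x ↑ˡ k′) ∈ bag′ (a ↑ˡ len D′) → x ∈ bag D a
    ll⁻ {x} a m = ∈-++ˡ⁻ (subst (x ↑ˡ k′ ∈_) (bagˡ a) m)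
    rr⁻ : ∀ {x} a → (k ↑ʳ x) ∈ bag′ (len D ↑ʳ a) → x ∈ bag D′ a
    rr⁻ {x} a m = ∈-++ʳ⁻ ⊥ (subst (k ↑ʳ x ∈_) (bagʳ a) m)
    lr⁻ : ∀ {x} a → ¬ (x ↑ˡ k′) ∈ bag′ (len D ↑ʳ a)
    lr⁻ {x} a m = ∉⊥ (∈-++ˡ⁻ (subst (x ↑ˡ k′ ∈_) (bagʳ a) m))
    rl⁻ : ∀ {x} a → ¬ (k ↑ʳ x) ∈ bag′ (a ↑ˡ len D′)
    rl⁻ {x} a m = ∉⊥ (∈-++ʳ⁻ (bag D a) (subst (k ↑ʳ x ∈_) (bagˡ a) m))
    covV : ∀ v → ∃[ a ] v ∈ bag′ a
    covV v with splitView k k′ v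
    ... | left x  = let a , m = covers-v D x in a ↑ˡ _ , ll⁺ m
    ... | right y = let a , m = covers-v D′ y in _ ↑ʳ a , rr⁺ m
    covE : ∀ u v → E (G ⊍ G′) u v → ∃[ a ] (u ∈ bag′ a × v ∈ bag′ a)
    covE u v e with splitView k k′ u | splitView k k′ v
    covE u v e | left x  | left y
      rewrite splitAt-↑ˡ k x k′ | splitAt-↑ˡ k y k′ =
        let a , m , n = covers-e D x y e in a ↑ˡ _ , ll⁺ m , ll⁺ n
    covE u v e | right x | right y
      rewrite splitAt-↑ʳ k k′ x | splitAt-↑ʳ k k′ y =
        let a , m , n = covers-e D′ x y e in _ ↑ʳ a , rr⁺ m , rr⁺ n
    covE u v e | left x  | right y
      rewrite splitAt-↑ˡ k x k′ | splitAt-↑ʳ k k′ y with () ← e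
    covE u v e | right x | left y
      rewrite splitAt-↑ʳ k k′ x | splitAt-↑ˡ k y k′ with () ← e
    ≤-left : ∀ {a b} → (a ↑ˡ len D′) Fin.≤ (b ↑ˡ len D′) → a Fin.≤ b
    ≤-left {a} {b} = subst₂ _≤_ (toℕ-↑ˡ a (len D′)) (toℕ-↑ˡ b (len D′))
    ≤-right : ∀ {a b} → (len D ↑ʳ a) Fin.≤ (len D ↑ʳ b) → a Fin.≤ b
    ≤-right {a} {b} p =
      +-cancelˡ-≤ (len D) _ _ (subst₂ _≤_ (toℕ-↑ʳ (len D) a) (toℕ-↑ʳ (len D) b) p)
    right≰left : ∀ a b → ¬ (len D ↑ʳ a) Fin.≤ (b ↑ˡ len D′)
    right≰left a b p = <⇒≱ (Finₚ.toℕ<n b)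
      (≤-trans (m≤m+n (len D) (toℕ a)) (subst₂ _≤_ (toℕ-↑ʳ (len D) a) (toℕ-↑ˡ b (len D′)) p))
    int : ∀ v a b c → a Fin.≤ b → b Fin.≤ c → v ∈ bag′ a → v ∈ bag′ c → v ∈ bag′ b
    int v a b c p q m n
      with splitView k k′ v | splitView (len D) (len D′) a
         | splitView (len D) (len D′) b | splitView (len D) (len D′) c
    ... | left x  | left a  | left b  | left c  =
          ll⁺ (interval D x a b c (≤-left p) (≤-left q) (ll⁻ a m) (ll⁻ c n))
    ... | left x  | right a | _       | _       = ⊥-elim (lr⁻ a m)
    ... | left x  | left a  | _       | right c = ⊥-elim (lr⁻ c n)
    ... | left x  | left a  | right b | left c  = ⊥-elim (right≰left b c q)
    ... | right x | left a  | _       | _       = ⊥-elim (rl⁻ a m)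
    ... | right x | right a | _       | left c  = ⊥-elim (rl⁻ c n)
    ... | right x | right a | left b  | right c = ⊥-elim (right≰left a b p)
    ... | right x | right a | right b | right c =
          rr⁺ (interval D′ x a b c (≤-right p) (≤-right q) (rr⁻ a m) (rr⁻ c n))
    wid : ∀ a → ∣ bag′ a ∣ ≤ suc w
    wid a with splitAt (len D) a
    ... | inj₁ a′ rewrite ∣p++q∣≡∣p∣+∣q∣ (bag D a′) (⊥ {n = k′})
                        | ∣⊥∣≡0 k′ | +-identityʳ ∣ bag D a′ ∣ = width D a′
    ... | inj₂ a′ rewrite ∣p++q∣≡∣p∣+∣q∣ (⊥ {n = k}) (bag D′ a′) | ∣⊥∣≡0 k = width D′ a′

copies-pathwidth : ∀ {w} m G → PathwidthAtMost (graph G) w → PathwidthAtMost (graph (copies m G)) w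
copies-pathwidth zero    G D = record
  { len = 0 ; bag = λ () ; covers-v = λ () ; covers-e = λ () ; interval = λ () ; width = λ () }
copies-pathwidth (suc m) G D = ⊍-pathwidth G (copies m G) D (copies-pathwidth m G D)

-- Paths, coloured by parity, and their pathwidth.

Path-edge⁻ : ∀ {N} {u v : Fin N} → Edge (Path N) u v → suc (toℕ u) ≡ toℕ v ⊎ suc (toℕ v) ≡ toℕ u
Path-edge⁻ {u = u} {v} e with suc (toℕ u) ℕ.≟ toℕ v | suc (toℕ v) ℕ.≟ toℕ u
... | yes p | _     = inj₁ p
... | no _  | yes q = inj₂ q
Path-edge⁻ () | no _ | no _

Path-edge⁺ : ∀ {N} {u v : Fin N} → suc (toℕ u) ≡ toℕ v → Edge (Path N) u v
Path-edge⁺ {u = u} {v} p with suc (toℕ u) ℕ.≟ toℕ v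
... | yes _ = refl
... | no ¬p = ⊥-elim (¬p p)

parity : ℕ → Bool
parity zero    = true
parity (suc m) = not (parity m)

diffB-not : ∀ b → diffB b (not b) ≡ true
diffB-not true  = refl
diffB-not false = refl

path : ℕ → ColouredGraph
path N = record
  { graph  = Path N
  ; colour = parity ∘ toℕ
  ; proper = λ u v e → prop u v (Path-edge⁻ e)
  }
  where
    prop : ∀ (u v : Fin N) → suc (toℕ u) ≡ toℕ v ⊎ suc (toℕ v) ≡ toℕ u →
      diffB (parity (toℕ u)) (parity (toℕ v)) ≡ true
    prop u v (inj₁ p) rewrite sym p = diffB-not (parity (toℕ u))
    prop u v (inj₂ q) rewrite sym q =
      trans (diffB-sym (not (parity (toℕ v))) _) (diffB-not (parity (toℕ v)))

path-pathwidth : ∀ N → PathwidthAtMost (Path (suc (suc N))) 1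
path-pathwidth N = record
  { len      = suc N
  ; bag      = bag′
  ; covers-v = λ { zero    → zero , x∈⁅x⁆∪⁅y⁆ zero (suc zero)
                 ; (suc v) → v , y∈⁅x⁆∪⁅y⁆ (inject₁ v) (suc v) }
  ; covers-e = λ u v e → cov u v (Path-edge⁻ e)
  ; interval = int
  ; width    = λ a → ∣⁅x⁆∪⁅y⁆∣≤2 (inject₁ a) (suc a)
  }
  where
    bag′ : Fin (suc N) → Subset (suc (suc N))
    bag′ a = ⁅ inject₁ a ⁆ ∪ ⁅ suc a ⁆
    -- Membership in bag `a` amounts to `a ≤ v ≤ a + 1`, which turns the interval property into a
    -- chain of inequalities.
    bag⁺ : ∀ {v} a → toℕ a ≤ toℕ v → toℕ v ≤ suc (toℕ a) → v ∈ bag′ a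
    bag⁺ {v} a p q with m≤n⇒m<n∨m≡n p
    ... | inj₁ a<v = subst (_∈ bag′ a) (toℕ-injective (≤-antisym a<v q)) (y∈⁅x⁆∪⁅y⁆ (inject₁ a) (suc a))
    ... | inj₂ a≡v = subst (_∈ bag′ a) (toℕ-injective (trans (Finₚ.toℕ-inject₁ a) a≡v))
                            (x∈⁅x⁆∪⁅y⁆ (inject₁ a) (suc a))
    bag⁻ : ∀ {v} a → v ∈ bag′ a → toℕ a ≤ toℕ v × toℕ v ≤ suc (toℕ a)
    bag⁻ a m with x∈⁅y⁆∪⁅z⁆⁻ (inject₁ a) (suc a) m
    ... | inj₁ refl rewrite Finₚ.toℕ-inject₁ a = ≤-refl , n≤1+n _
    ... | inj₂ refl = n≤1+n _ , ≤-refl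
    cov : ∀ u v → suc (toℕ u) ≡ toℕ v ⊎ suc (toℕ v) ≡ toℕ u → ∃[ a ] (u ∈ bag′ a × v ∈ bag′ a)
    cov u (suc v) (inj₁ p) =
      v , bag⁺ v (≤-reflexive (sym (suc-injective p))) (≤-trans (n≤1+n _) (≤-reflexive p)) ,
      y∈⁅x⁆∪⁅y⁆ (inject₁ v) (suc v)
    cov (suc u) v (inj₂ q) =
      u , y∈⁅x⁆∪⁅y⁆ (inject₁ u) (suc u) ,
      bag⁺ u (≤-reflexive (sym (suc-injective q))) (≤-trans (n≤1+n _) (≤-reflexive q))
    int : ∀ v a b c → a Fin.≤ b → b Fin.≤ c → v ∈ bag′ a → v ∈ bag′ c → v ∈ bag′ b
    int v a b c p q m n =
      bag⁺ b (≤-trans q (proj₁ (bag⁻ c n))) (≤-trans (proj₂ (bag⁻ a m)) (s≤s p))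

-- Self-avoiding paths in walks that visit each vertex boundedly often.

-- A number of steps that forces a self-avoiding path with `L` edges when each vertex is visited at
-- most `c` times: `c` windows, each with one step to leave the start and enough steps to continue
-- with one edge fewer.
enoughSteps : ℕ → ℕ → ℕ
enoughSteps c zero    = 0
enoughSteps c (suc L) = c * suc (enoughSteps c L)

module _ {A : Set} (_≟_ : DecidableEquality A) (w : ℕ → A) where

  -- From a visit to `v`, the next `F` times are searched for a return. If there is none, the
  -- excursion is found; otherwise the search restarts at the return, at most `F` steps later, until
  -- `m` returns have been collected.
  gap : ∀ F m a v → w a ≡ v →
    (∃[ b ] (w b ≡ v × a ≤ b × b + F ≤ a + m * F × (∀ s → s < F → w (suc b + s) ≢ v)))
    ⊎ (Σ (Fin (suc m) → ℕ) λ g →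
         Injective _≡_ _≡_ g × (∀ s → a ≤ g s × g s ≤ a + m * F × w (g s) ≡ v))
  gap F zero a v wa =
    inj₂ ((λ _ → a) , (λ { {zero} {zero} _ → refl }) , λ _ → ≤-refl , m≤m+n a 0 , wa)
  gap F (suc m) a v wa with Finₚ.any? (λ (s : Fin F) → w (suc a + toℕ s) ≟ v)
  ... | no never =
        inj₁ (a , wa , ≤-refl , +-monoʳ-≤ a (m≤m+n F (m * F)) , λ s s<F ws →
          never (fromℕ< s<F , subst (λ t → w (suc a + t) ≡ v) (sym (Finₚ.toℕ-fromℕ< s<F)) ws))
  ... | yes (s , ws) = Sum.map early visits (gap F m a′ v ws)
    where
    a′ = suc a + toℕ s
    a<a′ : a < a′
    a<a′ = s≤s (m≤m+n a (toℕ s))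
    step≤ : a′ + m * F ≤ a + (F + m * F)
    step≤ = ≤-trans
      (+-monoˡ-≤ (m * F) (subst (_≤ a + F) (+-suc a (toℕ s)) (+-monoʳ-≤ a (Finₚ.toℕ<n s))))
      (≤-reflexive (+-assoc a F (m * F)))
    early : _ → _
    early (b , wb , a′≤b , b≤ , avoid) = b , wb , ≤-trans (<⇒≤ a<a′) a′≤b , ≤-trans b≤ step≤ , avoid
    visits : _ → _
    visits (g , g-inj , gs) = g′ , g′-inj , gs′
      where
      g′ : Fin (suc (suc m)) → ℕ
      g′ zero    = a
      g′ (suc s) = g s
      g′-inj : Injective _≡_ _≡_ g′
      g′-inj {zero}  {zero}  eq = refl
      g′-inj {zero}  {suc t} eq = ⊥-elim (<⇒≢ (<-≤-trans a<a′ (proj₁ (gs t))) eq)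
      g′-inj {suc s} {zero}  eq = ⊥-elim (<⇒≢ (<-≤-trans a<a′ (proj₁ (gs s))) (sym eq))
      g′-inj {suc s} {suc t} eq = cong suc (g-inj eq)
      gs′ : ∀ s → a ≤ g′ s × g′ s ≤ a + suc m * F × w (g′ s) ≡ v
      gs′ zero    = ≤-refl , m≤m+n a _ , wa
      gs′ (suc s) = let p , q , r = gs s in ≤-trans (<⇒≤ a<a′) p , ≤-trans q step≤ , r

  -- The r-th vertex of the path is `w (time r)`. By `linked` the walk steps from it directly to the
  -- next vertex of the path, although `time (suc r)` may be a later visit to that vertex. Likewise
  -- `time 0` may be a later visit to `w a`.
  record SelfAvoiding (L a z : ℕ) : Set where
    field
      time     : ℕ → ℕ
      start    : w (time 0) ≡ w a
      within   : ∀ r → r ≤ L → a ≤ time r × time r ≤ z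
      linked   : ∀ r → r < L → w (suc (time r)) ≡ w (time (suc r))
      distinct : ∀ r s → r < s → s ≤ L → w (time r) ≢ w (time s)
  open SelfAvoiding

  -- Between two of its at most c visits to w a, the walk makes an excursion that avoids w a and is
  -- long enough to recurse on; it starts at a neighbour of w a.
  selfAvoiding : ∀ c N →
    (∀ (g : Fin (suc c) → ℕ) → Injective _≡_ _≡_ g → (∀ s → g s < N) → ∀ v → ¬ (∀ s → w (g s) ≡ v)) →
    ∀ L a → a + enoughSteps c L < N → SelfAvoiding L a (a + enoughSteps c L)
  selfAvoiding c N bounded zero a _ = record
    { time     = λ _ → a
    ; start    = refl
    ; within   = λ _ _ → ≤-refl , m≤m+n a 0
    ; linked   = λ _ ()
    ; distinct = λ { r zero () _ ; r (suc s) _ () }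
    }
  selfAvoiding c N bounded (suc L) a a+f<N with gap (suc (enoughSteps c L)) c a (w a) refl
  ... | inj₂ (g , g-inj , gs) =
        ⊥-elim (bounded g g-inj (λ s → ≤-<-trans (proj₁ (proj₂ (gs s))) a+f<N) (w a)
          (λ s → proj₂ (proj₂ (gs s))))
  ... | inj₁ (b , wb , a≤b , b≤ , avoid) = record
    { time = time′ ; start = wb ; within = within′ ; linked = linked′ ; distinct = distinct′ }
    where
    F = enoughSteps c L
    end≤ : suc b + F ≤ a + c * suc F
    end≤ = ≤-trans (≤-reflexive (sym (+-suc b F))) b≤
    rest : SelfAvoiding L (suc b) (suc b + F)
    rest = selfAvoiding c N bounded L (suc b) (≤-<-trans end≤ a+f<N)
    time′ : ℕ → ℕ
    time′ zero    = b
    time′ (suc r) = time rest r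
    within′ : ∀ r → r ≤ suc L → a ≤ time′ r × time′ r ≤ a + c * suc F
    within′ zero    _       = a≤b , ≤-trans (≤-trans (n≤1+n b) (m≤m+n (suc b) F)) end≤
    within′ (suc r) (s≤s p) = let x , y = within rest r p in
      ≤-trans a≤b (≤-trans (n≤1+n b) x) , ≤-trans y end≤
    linked′ : ∀ r → r < suc L → w (suc (time′ r)) ≡ w (time′ (suc r))
    linked′ zero    _       = sym (start rest)
    linked′ (suc r) (s≤s p) = linked rest r p
    -- All times of `rest` lie in the window from `suc b` to `suc b + F`, on which `avoid` excludes
    -- `w a`; the offset in the window is recovered by subtraction.
    avoid′ : ∀ r → r ≤ L → w (time rest r) ≢ w a
    avoid′ r p = let x , y = within rest r p in
      subst (λ t → w t ≢ w a) (m+[n∸m]≡n x)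
        (avoid (time rest r ∸ suc b)
          (s≤s (≤-trans (∸-monoˡ-≤ (suc b) y) (≤-reflexive (m+n∸m≡n (suc b) F)))))
    distinct′ : ∀ r s → r < s → s ≤ suc L → w (time′ r) ≢ w (time′ s)
    distinct′ zero    (suc s) _       (s≤s q) eq = avoid′ s q (trans (sym eq) wb)
    distinct′ (suc r) (suc s) (s≤s p) (s≤s q) eq = distinct rest r s p q eq

-- Projections to H and the skeletons found in them.

-- What is retained of an embedding in the strong product: an edge projects to an edge or collapses,
-- and at most `c` vertices lie over any vertex of H, stated as the absence of `suc c` distinct
-- ones.
record Projection (G : ColouredGraph) (H : Graph) (c : ℕ) : Set where
  field
    π     : V G → Fin (size H)
    edges : ∀ {u v} → E G u v → π u ≡ π v ⊎ Edge H (π u) (π v)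
    fibre : ∀ (g : Fin (suc c) → V G) → Injective _≡_ _≡_ g → ∀ h → ¬ (∀ s → π (g s) ≡ h)
open Projection

pullback : ∀ {G G′ H c} → Embedding G′ G → Projection G H c → Projection G′ H c
pullback f P = record
  { π     = π P ∘ to f
  ; edges = λ e → edges P (edge f e)
  ; fibre = λ g g-inj → fibre P (to f ∘ g) (g-inj ∘ injective f)
  }

-- Apices u_s and n two-vertex rungs strung along a path, pairwise disjoint after projection to H.
record Skeleton {G H c} (P : Projection G H c) {r} (col : Fin r → Bool) (n : ℕ) : Set where
  field
    apex        : Fin r → V G
    rung        : Fin n → Fin 2 → V G
    apex-colour : ∀ s → colour G (apex s) ≡ col s
    apex-apex   : ∀ s t → diffB (col s) (col t) ≡ true → E G (apex s) (apex t)
    apex-rung   : ∀ s t i → diffB (col s) (colour G (rung t i)) ≡ true → E G (apex s) (rung t i)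
    rung-edge   : ∀ t → E G (rung t zero) (rung t (suc zero))
    rung-next   : ∀ t t′ → suc (toℕ t) ≡ toℕ t′ →
                  Edge H (π P (rung t (suc zero))) (π P (rung t′ zero))
    apex-inj    : ∀ s t → π P (apex s) ≡ π P (apex t) → s ≡ t
    rung-inj    : ∀ t i t′ i′ → π P (rung t i) ≡ π P (rung t′ i′) → t ≡ t′
    apex≢rung   : ∀ s t i → π P (apex s) ≢ π P (rung t i)
open Skeleton

-- The projected path is a walk with at most `c` visits to each vertex, so it contains a
-- self-avoiding path with `n * 2` edges; rung `t` takes its positions 2t and 2t + 1.
path-skeleton : ∀ {H c} n N → enoughSteps c (n * 2) ≤ N → (P : Projection (path (suc (suc N))) H c) →
  (col : Fin 0 → Bool) → Skeleton P col n
path-skeleton {H} {c} n N f≤N P col = record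
  { apex = λ () ; apex-colour = λ () ; apex-apex = λ ()
  ; apex-rung = λ () ; apex-inj = λ () ; apex≢rung = λ ()
  ; rung      = rung′
  ; rung-edge = λ t → p-edge _ (bound _ (idx≤ t zero))
  ; rung-next = next
  ; rung-inj  = λ t i t′ i′ eq → Finₚ.combine-injectiveˡ t i t′ i′
      (toℕ-injective (time-inj _ _ (idx≤ t i) (idx≤ t′ i′)
        (trans (sym (π-rung t i)) (trans eq (π-rung t′ i′)))))
  }
  where
  N″ = suc (suc N)
  -- Reduction mod `N″` only makes the walk total on ℕ; at the times in use it changes nothing.
  p : ℕ → Fin N″
  p t = t mod N″
  toℕ-p : ∀ {t} → t < N″ → toℕ (p t) ≡ t
  toℕ-p {t} t<N″ = trans (Finₚ.toℕ-fromℕ< (m%n<n t N″)) (m<n⇒m%n≡m t<N″)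
  p-edge : ∀ t → suc t < N″ → E (path N″) (p t) (p (suc t))
  p-edge t t<N″ = Path-edge⁺ (trans (cong suc (toℕ-p (<-trans ≤-refl t<N″))) (sym (toℕ-p t<N″)))
  w : ℕ → Fin (size H)
  w = π P ∘ p
  S : SelfAvoiding Finₚ._≟_ w (n * 2) 0 (0 + enoughSteps c (n * 2))
  S = selfAvoiding Finₚ._≟_ w c N″
    (λ g g-inj g< v → fibre P (p ∘ g)
      (λ {s} {t} eq → g-inj (trans (sym (toℕ-p (g< s))) (trans (cong toℕ eq) (toℕ-p (g< t))))) v)
    (n * 2) 0 (s≤s (≤-trans f≤N (n≤1+n N)))
  open SelfAvoiding S
  idx : Fin n → Fin 2 → ℕ
  idx t i = toℕ (combine t i)
  idx< : ∀ t i → idx t i < n * 2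
  idx< t i = Finₚ.toℕ<n (combine t i)
  idx≤ : ∀ t i → idx t i ≤ n * 2
  idx≤ t i = <⇒≤ (idx< t i)
  idx-suc : ∀ t → suc (idx t zero) ≡ idx t (suc zero)
  idx-suc t rewrite Finₚ.toℕ-combine t (zero {1}) | Finₚ.toℕ-combine t (suc (zero {0})) =
    sym (+-suc (2 * toℕ t) 0)
  idx-next : ∀ t t′ → suc (toℕ t) ≡ toℕ t′ → suc (idx t (suc zero)) ≡ idx t′ zero
  idx-next t t′ eq
    rewrite Finₚ.toℕ-combine t (suc (zero {0})) | Finₚ.toℕ-combine t′ (zero {1}) | sym eq
          = trans (cong suc (+-suc (2 * toℕ t) 0)) (cong (_+ 0) (sym (*-suc 2 (toℕ t))))
  -- Times are at most `N` and the path has `N + 2` vertices, so the step after each chosen time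
  -- stays on the path.
  bound : ∀ r → r ≤ n * 2 → suc (time r) < N″
  bound r r≤ = s≤s (s≤s (≤-trans (proj₂ (within r r≤)) f≤N))
  rung′ : Fin n → Fin 2 → Fin N″
  -- The second end is the successor in G of the first, not the vertex at the next chosen time: the
  -- ends are thus adjacent in G and differ in colour, while `linked` gives the second the right
  -- projection.
  rung′ t zero       = p (time (idx t zero))
  rung′ t (suc zero) = p (suc (time (idx t zero)))
  π-rung : ∀ t i → π P (rung′ t i) ≡ w (time (idx t i))
  π-rung t zero       = refl
  π-rung t (suc zero) = trans (linked _ (idx< t zero)) (cong (w ∘ time) (idx-suc t))
  time-inj : ∀ r s → r ≤ n * 2 → s ≤ n * 2 → w (time r) ≡ w (time s) → r ≡ s
  time-inj r s p q eq with <-cmp r s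
  ... | tri< r<s _ _ = ⊥-elim (distinct r s r<s q eq)
  ... | tri≈ _ r≡s _ = r≡s
  ... | tri> _ _ s<r = ⊥-elim (distinct s r s<r p (sym eq))
  -- The edge of G leaving the chosen time at position 2t + 1 projects onto this pair; it cannot
  -- collapse, as positions 2t + 1 and 2t + 2 have distinct projections.
  next : ∀ t t′ → suc (toℕ t) ≡ toℕ t′ → Edge H (π P (rung′ t (suc zero))) (π P (rung′ t′ zero))
  next t t′ eq
    rewrite π-rung t (suc zero) | sym (idx-next t t′ eq) | sym (linked _ (idx< t (suc zero)))
    with edges P (p-edge _ (bound _ (idx≤ t (suc zero))))
  ... | inj₂ e = e
  ... | inj₁ same = ⊥-elim (distinct _ _ ≤-refl (idx< t (suc zero))
          (trans same (linked _ (idx< t (suc zero)))))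

-- If all `suc c` disjoint copies met the fibre over `h`, that fibre would contain `suc c` distinct
-- vertices.
avoiding-copy : ∀ {G H c} (P : Projection (copies (suc c) G) H c) h →
  ∃[ s ] (∀ u → π P (to (copy G s) u) ≢ h)
avoiding-copy {G} {H} {c} P h = decide (Finₚ.all? meets?)
  where
  Meets : Fin (suc c) → Set
  Meets s = ∃[ u ] π P (to (copy G s) u) ≡ h
  meets? : Decidable Meets
  meets? s = Finₚ.any? (λ u → π P (to (copy G s) u) Finₚ.≟ h)
  decide : Dec (∀ s → Meets s) → ∃[ s ] (∀ u → π P (to (copy G s) u) ≢ h)
  decide (yes meets) = ⊥-elim (fibre P (λ s → to (copy G s) (proj₁ (meets s)))
    (λ {s} {t} → copy-disjoint G s t) h (proj₂ ∘ meets))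
  decide (no ¬meets) =
    let s , avoids = Finₚ.¬∀⟶∃¬ (suc c) Meets meets? ¬meets in s , λ u eq → avoids (u , eq)

-- The copy depends on the projection, so a skeleton is demanded for every projection of `G`. In a
-- copy avoiding the projection of the new apex, that apex collides with nothing, and preserved
-- colours make it adjacent to whatever it has to be.
cone-skeleton : ∀ {G H c r n} {col : Fin (suc r) → Bool}
  (P : Projection (cone (col zero) (copies (suc c) G)) H c) →
  ((Q : Projection G H c) → Skeleton Q (col ∘ suc) n) → Skeleton P col n
cone-skeleton {G} {H} {c} {r} {n} {col} P below = record
  { apex        = apex′
  ; rung        = λ t i → to f (rung S t i)
  ; apex-colour = λ { zero → refl ; (suc s) → trans (colour≡ f (apex S s)) (apex-colour S s) }
  ; apex-apex   = aa
  ; apex-rung   = ar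
  ; rung-edge   = λ t → edge f (rung-edge S t)
  ; rung-next   = rung-next S
  ; apex-inj    = ai
  ; rung-inj    = rung-inj S
  ; apex≢rung   = λ { zero t i eq → avoids _ (sym eq) ; (suc s) t i → apex≢rung S s t i }
  }
  where
  base : Embedding (copies (suc c) G) (cone (col zero) (copies (suc c) G))
  base = cone-base (col zero) (copies (suc c) G)
  chosen : ∃[ s ] (∀ u → π P (suc (to (copy {suc c} G s) u)) ≢ π P zero)
  chosen = avoiding-copy (pullback base P) (π P zero)
  avoids = proj₂ chosen
  f : Embedding G (cone (col zero) (copies (suc c) G))
  f = base ∘ₑ copy G (proj₁ chosen)
  S : Skeleton (pullback f P) (col ∘ suc) n
  S = below (pullback f P)
  C = cone (col zero) (copies (suc c) G)
  top-edge : ∀ u → diffB (col zero) (colour G u) ≡ true → E C zero (to f u)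
  top-edge u d = subst (λ b → diffB (col zero) b ≡ true) (sym (colour≡ f u)) d
  apex′ : Fin (suc r) → V C
  apex′ zero    = zero
  apex′ (suc s) = to f (apex S s)
  aa : ∀ s t → diffB (col s) (col t) ≡ true → E C (apex′ s) (apex′ t)
  aa zero    zero    d = ⊥-elim (diffB⇒≢ d refl)
  aa zero    (suc t) d =
    top-edge (apex S t) (subst (λ b → diffB (col zero) b ≡ true) (sym (apex-colour S t)) d)
  aa (suc s) zero    d =
    E-sym (graph C) {zero} {to f (apex S s)} (aa zero (suc s) (trans (diffB-sym (col zero) (col (suc s))) d))
  aa (suc s) (suc t) d = edge f (apex-apex S s t d)
  ar : ∀ s t i → diffB (col s) (colour C (to f (rung S t i))) ≡ true → E C (apex′ s) (to f (rung S t i))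
  ar zero    t i d = d
  ar (suc s) t i d = edge f (apex-rung S s t i
    (subst (λ b → diffB (col (suc s)) b ≡ true) (colour≡ f (rung S t i)) d))
  ai : ∀ s t → π P (apex′ s) ≡ π P (apex′ t) → s ≡ t
  ai zero    zero    eq = refl
  ai zero    (suc t) eq = ⊥-elim (avoids (apex S t) (sym eq))
  ai (suc s) zero    eq = ⊥-elim (avoids (apex S s) eq)
  ai (suc s) (suc t) eq = cong suc (apex-inj S s t eq)

-- The graph G: one cone over disjoint copies for each apex.

tower : (c N : ℕ) → ∀ {r} → (Fin r → Bool) → ColouredGraph
tower c N {zero}  col = path (suc (suc N))
tower c N {suc r} col = cone (col zero) (copies (suc c) (tower c N (col ∘ suc)))

-- The path contributes 1, each of the `r` cones another 1, and copying nothing.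
tower-pathwidth : ∀ c N {r} (col : Fin r → Bool) → PathwidthAtMost (graph (tower c N col)) (suc r)
tower-pathwidth c N {zero}  col = path-pathwidth N
tower-pathwidth c N {suc r} col =
  cone-pathwidth (col zero) _ (copies-pathwidth (suc c) _ (tower-pathwidth c N (col ∘ suc)))

tower-skeleton : ∀ {H} c n {r} (col : Fin r → Bool)
  (P : Projection (tower c (enoughSteps c (n * 2)) col) H c) →
  Skeleton P col n
tower-skeleton c n {zero}  col P = path-skeleton n _ ≤-refl P col
tower-skeleton c n {suc r} col P = cone-skeleton P (tower-skeleton c n (col ∘ suc))

-- Both colours occur, so an apex of either colour has a neighbour. This carries `NoIsolated`
-- through the cones, on which the bound on the radius rests.
SeesBoth : ColouredGraph → Set
SeesBoth G = ∀ b → ∃[ v ] diffB b (colour G v) ≡ true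

NoIsolated : ColouredGraph → Set
NoIsolated G = ∀ u → ∃[ v ] E G u v

copies-seesBoth : ∀ m G → SeesBoth G → SeesBoth (copies (suc m) G)
copies-seesBoth m G both b = let v , d = both b in
  to (copy {suc m} G zero) v , subst (λ c → diffB b c ≡ true) (sym (colour≡ (copy {suc m} G zero) v)) d

copies-noIsolated : ∀ m G → NoIsolated G → NoIsolated (copies m G)
copies-noIsolated (suc m) G nbr u with splitView (size (graph G)) (size (graph (copies m G))) u
... | left x  = let v , e = nbr x in _ , edge (⊍-left G (copies m G)) e
... | right x = let v , e = copies-noIsolated m G nbr x in _ , edge (⊍-right G (copies m G)) e

tower-seesBoth : ∀ c N {r} (col : Fin r → Bool) → SeesBoth (tower c N col)
tower-seesBoth c N {zero}  col true  = suc zero , refl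
tower-seesBoth c N {zero}  col false = zero , refl
tower-seesBoth c N {suc r} col b =
  let v , d = copies-seesBoth c _ (tower-seesBoth c N (col ∘ suc)) b in suc v , d

tower-noIsolated : ∀ c N {r} (col : Fin r → Bool) → NoIsolated (tower c N col)
tower-noIsolated c N {zero}  col zero    = suc zero , refl
tower-noIsolated c N {zero}  col (suc v) =
  inject₁ v , E-sym (Path (suc (suc N))) {inject₁ v} {suc v} (Path-edge⁺ (cong suc (Finₚ.toℕ-inject₁ v)))
tower-noIsolated c N {suc r} col zero    =
  let v , d = copies-seesBoth c _ (tower-seesBoth c N (col ∘ suc)) (col zero) in suc v , d
tower-noIsolated c N {suc r} col (suc u) =
  let v , e = copies-noIsolated (suc c) _ (tower-noIsolated c N (col ∘ suc)) u in suc v , e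

-- A vertex of the apex's colour reaches the apex through any of its neighbours.
cone-radius : ∀ b G → NoIsolated G → ∀ u →
  E (cone b G) zero (suc u) ⊎ (∃[ v ] (E (cone b G) zero v × E (cone b G) v (suc u)))
cone-radius b G nbr u with diffB-choice (proper G u _ (proj₂ (nbr u))) b
... | inj₁ d = inj₁ d
... | inj₂ d = let v , e = nbr u in inj₂ (suc v , d , E-sym (graph G) e)

-- From skeletons to 2-small minors.

-- The two picked vertices may coincide, so that branch sets of one and of two vertices are treated
-- alike.
pairModel : ∀ {F H : Graph} (pick : Fin (size F) → Fin 2 → Fin (size H)) →
  (∀ v i w j → pick v i ≡ pick w j → v ≡ w) →
  (∀ v → pick v zero ≡ pick v (suc zero) ⊎ Edge H (pick v zero) (pick v (suc zero))) →
  (∀ v w → Edge F v w → ∃[ i ] ∃[ j ] Edge H (pick v i) (pick w j)) →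
  SmallMinor 2 F H
pairModel {F} {H} pick inj join touch = record
  { μ         = μ
  ; connected = λ v → (pick v zero , ∈μ v zero) , conn v
  ; disjoint  = λ v w v≢w x xv xw →
      let i , p = μ∋ v xv ; j , q = μ∋ w xw in v≢w (inj v i w j (trans (sym p) q))
  ; edges     = λ v w e → let i , j , e′ = touch v w e in pick v i , pick w j , ∈μ v i , ∈μ w j , e′
  ; small     = λ v → ∣⁅x⁆∪⁅y⁆∣≤2 (pick v zero) (pick v (suc zero))
  }
  where
  μ : Fin (size F) → Subset (size H)
  μ v = ⁅ pick v zero ⁆ ∪ ⁅ pick v (suc zero) ⁆
  ∈μ : ∀ v i → pick v i ∈ μ v
  ∈μ v zero       = x∈⁅x⁆∪⁅y⁆ (pick v zero) (pick v (suc zero))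
  ∈μ v (suc zero) = y∈⁅x⁆∪⁅y⁆ (pick v zero) (pick v (suc zero))
  μ∋ : ∀ v {x} → x ∈ μ v → ∃[ i ] x ≡ pick v i
  μ∋ v m with x∈⁅y⁆∪⁅z⁆⁻ (pick v zero) (pick v (suc zero)) m
  ... | inj₁ p = zero , p
  ... | inj₂ p = suc zero , p
  walk : ∀ v i j → WalkIn H (μ v) (pick v i) (pick v j)
  walk v zero       zero       = stop (∈μ v zero)
  walk v (suc zero) (suc zero) = stop (∈μ v (suc zero))
  walk v zero       (suc zero) with join v
  ... | inj₁ p = subst (WalkIn H (μ v) (pick v zero)) p (stop (∈μ v zero))
  ... | inj₂ e = step (∈μ v zero) e (stop (∈μ v (suc zero)))
  walk v (suc zero) zero       with join v
  ... | inj₁ p = subst (λ x → WalkIn H (μ v) x (pick v zero)) p (stop (∈μ v zero))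
  ... | inj₂ e = step (∈μ v (suc zero)) (E-sym H e) (stop (∈μ v zero))
  conn : ∀ v x y → x ∈ μ v → y ∈ μ v → WalkIn H (μ v) x y
  conn v x y xv yv with μ∋ v xv | μ∋ v yv
  ... | i , refl | j , refl = walk v i j

-- Rungs project to the branch sets of the path and apices to those of `Kbip`, coloured by their
-- side. The injectivity fields of the skeleton rule out that an edge between different branch sets
-- collapses.
skeleton⇒minor : ∀ {G H c i j n} (P : Projection G H c) → Skeleton P (inFirst i {j}) n →
  SmallMinor 2 (Path n ⊕ Kbip i j) H
skeleton⇒minor {G} {H} {c} {i} {j} {n} P S =
  pairModel {Path n ⊕ Kbip i j} (λ v → pick (splitAt n v)) inj (λ v → close (splitAt n v))
    (λ v w → touch (splitAt n v) (splitAt n w))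
  where
  pick : Fin n ⊎ Fin (i + j) → Fin 2 → Fin (size H)
  pick (inj₁ t) b = π P (rung S t b)
  pick (inj₂ s) _ = π P (apex S s)
  pick-inj : ∀ p b q b′ → pick p b ≡ pick q b′ → p ≡ q
  pick-inj (inj₁ t) b (inj₁ t′) b′ eq = cong inj₁ (rung-inj S t b t′ b′ eq)
  pick-inj (inj₁ t) b (inj₂ s)  b′ eq = ⊥-elim (apex≢rung S s t b (sym eq))
  pick-inj (inj₂ s) b (inj₁ t)  b′ eq = ⊥-elim (apex≢rung S s t b′ eq)
  pick-inj (inj₂ s) b (inj₂ s′) b′ eq = cong inj₂ (apex-inj S s s′ eq)
  inj : ∀ v b w b′ → pick (splitAt n v) b ≡ pick (splitAt n w) b′ → v ≡ w
  inj v b w b′ eq = trans (sym (join-splitAt n (i + j) v))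
    (trans (cong (join n (i + j)) (pick-inj (splitAt n v) b (splitAt n w) b′ eq))
      (join-splitAt n (i + j) w))
  close : ∀ p → pick p zero ≡ pick p (suc zero) ⊎ Edge H (pick p zero) (pick p (suc zero))
  close (inj₁ t) = edges P (rung-edge S t)
  close (inj₂ s) = inj₁ refl
  -- The ends of a rung differ in colour, so one of them is adjacent in G to the apex.
  apex-touch : ∀ s t → ∃[ b ] Edge H (π P (apex S s)) (π P (rung S t b))
  apex-touch s t with diffB-choice (proper G _ _ (rung-edge S t)) (inFirst i s)
  ... | inj₁ d = zero , distinct (edges P (apex-rung S s t zero d))
    where distinct = [ (λ eq → ⊥-elim (apex≢rung S s t zero eq)) , id ]′
  ... | inj₂ d = suc zero , distinct (edges P (apex-rung S s t (suc zero) d))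
    where distinct = [ (λ eq → ⊥-elim (apex≢rung S s t (suc zero) eq)) , id ]′
  touch : ∀ p q → joinAdj (adj (Path n)) (adj (Kbip i j)) p q ≡ true →
    ∃[ b ] ∃[ b′ ] Edge H (pick p b) (pick q b′)
  touch (inj₁ t) (inj₁ t′) e with Path-edge⁻ {u = t} {t′} e
  ... | inj₁ eq = suc zero , zero , rung-next S t t′ eq
  ... | inj₂ eq = zero , suc zero , E-sym H (rung-next S t′ t eq)
  touch (inj₁ t) (inj₂ s) e = let b , e′ = apex-touch s t in b , zero , E-sym H e′
  touch (inj₂ s) (inj₁ t) e = let b , e′ = apex-touch s t in zero , b , e′
  touch (inj₂ s) (inj₂ s′) e with edges P (apex-apex S s s′ e)
  ... | inj₁ eq = ⊥-elim (diffB⇒≢ e (cong (inFirst i) (apex-inj S s s′ eq)))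
  ... | inj₂ e′ = zero , zero , e′

-- Strong products: bounding the fibres over H.

eqF∨⁻ : ∀ {m} {x y : Fin m} {b} → eqF x y ∨ b ≡ true → x ≡ y ⊎ b ≡ true
eqF∨⁻ {x = x} {y} e with x Fin.≟ y
... | yes p = inj₁ p
... | no _  = inj₂ e

⊠-edge⁻ : ∀ {A B} {u v : Fin (size (A ⊠ B))} → Edge (A ⊠ B) u v →
  let x , y = remQuot (size B) u ; x′ , y′ = remQuot (size B) v in
  (x ≡ x′ ⊎ Edge A x x′) × (y ≡ y′ ⊎ Edge B y y′)
⊠-edge⁻ {A} {B} {u} {v} e =
  eqF∨⁻ (∧-conicalˡ (eqF x x′ ∨ adj A x x′) _ e′) , eqF∨⁻ (∧-conicalʳ (eqF x x′ ∨ adj A x x′) _ e′)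
  where
  x = proj₁ (remQuot (size B) u)
  x′ = proj₁ (remQuot (size B) v)
  e′ = ∧-conicalʳ (not (eqF u v)) _ e

remQuot-injective : ∀ {m} k {u v : Fin (m * k)} →
  proj₁ (remQuot {m} k u) ≡ proj₁ (remQuot {m} k v) →
  proj₂ (remQuot {m} k u) ≡ proj₂ (remQuot {m} k v) → u ≡ v
remQuot-injective {m} k {u} {v} p q = trans (sym (Finₚ.combine-remQuot {m} k u))
  (trans (cong₂ combine p q) (Finₚ.combine-remQuot {m} k v))

-- Distance at most `d` on the line, written without subtraction.
Within : ℕ → ℕ → ℕ → Set
Within d a b = a ≤ d + b × b ≤ d + a

within-refl : ∀ d a → Within d a a
within-refl d a = m≤n+m a d , m≤n+m a d

within-trans : ∀ {d e a b c} → Within d a b → Within e b c → Within (d + e) a c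
within-trans {d} {e} {a} {b} {c} (p , p′) (q , q′) =
  ≤-trans p (≤-trans (+-monoʳ-≤ d q) (≤-reflexive (sym (+-assoc d e c)))) ,
  ≤-trans q′ (≤-trans (+-monoʳ-≤ e p′)
    (≤-reflexive (trans (sym (+-assoc e d a)) (cong (_+ a) (+-comm e d)))))

module ProductEmbedding (G : ColouredGraph) (H : Graph) (m ℓ : ℕ)
  (emb : SubgraphOf (graph G) ((H ⊠ Path (suc m)) ⊠ K ℓ)) where

  private
    f = proj₁ emb
    slot : V G → Fin ℓ
    slot u = proj₂ (remQuot {size H * suc m} ℓ (f u))
    rest : V G → Fin (size H * suc m)
    rest u = proj₁ (remQuot ℓ (f u))
    base : V G → Fin (size H)
    base u = proj₁ (remQuot (suc m) (rest u))

  layer : V G → ℕ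
  layer u = toℕ (proj₂ (remQuot {size H} (suc m) (rest u)))

  base-edge : ∀ {u v} → E G u v → base u ≡ base v ⊎ Edge H (base u) (base v)
  base-edge {u} {v} e
    with proj₁ (⊠-edge⁻ {H ⊠ Path (suc m)} {K ℓ} {f u} {f v} (proj₂ (proj₂ emb) u v e))
  ... | inj₁ eq = inj₁ (cong (λ x → proj₁ (remQuot (suc m) x)) eq)
  ... | inj₂ e′ = proj₁ (⊠-edge⁻ {H} {Path (suc m)} {rest u} {rest v} e′)

  layer-edge : ∀ {u v} → E G u v → Within 1 (layer u) (layer v)
  layer-edge {u} {v} e
    with proj₁ (⊠-edge⁻ {H ⊠ Path (suc m)} {K ℓ} {f u} {f v} (proj₂ (proj₂ emb) u v e))
  ... | inj₁ eq rewrite eq = within-refl 1 _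
  ... | inj₂ e′ with proj₂ (⊠-edge⁻ {H} {Path (suc m)} {rest u} {rest v} e′)
  ...   | inj₁ eq rewrite eq = within-refl 1 _
  ...   | inj₂ e″ with Path-edge⁻ {u = proj₂ (remQuot {size H} (suc m) (rest u))} e″
  ...     | inj₁ eq = ≤-trans (n≤1+n _) (≤-trans (≤-reflexive eq) (n≤1+n _)) , ≤-reflexive (sym eq)
  ...     | inj₂ eq = ≤-reflexive (sym eq) , ≤-trans (n≤1+n _) (≤-trans (≤-reflexive eq) (n≤1+n _))

  module _ (root : V G) (radius : ∀ u → Within 2 (layer root) (layer u)) where
    private
      -- Layers differ from that of the root by at most 2; the shift by 2 keeps the subtraction from
      -- truncating and gives offsets 0 to 4.
      offset : V G → ℕ
      offset u = 2 + layer u ∸ layer root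
      offset< : ∀ u → offset u < 5
      offset< u = s≤s (m≤n+o⇒m∸n≤o (2 + layer u) (layer root)
        (subst (2 + layer u ≤_) (+-comm 4 (layer root)) (+-monoʳ-≤ 2 (proj₂ (radius u)))))
      offset-inj : ∀ u v → offset u ≡ offset v → layer u ≡ layer v
      offset-inj u v eq = +-cancelˡ-≡ 2 _ _ (∸-cancelʳ-≡ (proj₁ (radius u)) (proj₁ (radius v)) eq)
      cell : V G → Fin (5 * ℓ)
      cell u = combine (fromℕ< (offset< u)) (slot u)
      cell-inj : ∀ {u v} → base u ≡ base v → cell u ≡ cell v → u ≡ v
      cell-inj {u} {v} b≡ c≡ =
        let o≡ , s≡ = Finₚ.combine-injective (fromℕ< (offset< u)) (slot u) (fromℕ< (offset< v)) (slot v) c≡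
            l≡ = toℕ-injective (offset-inj u v (Finₚ.fromℕ<-injective _ _ (offset< u) (offset< v) o≡))
        in proj₁ (proj₂ emb) (remQuot-injective {size H * suc m} ℓ
             (remQuot-injective {size H} (suc m) b≡ l≡) s≡)

    -- A vertex is determined by its base in H and its cell, and there are 5 layers times `ℓ` slots;
    -- by pigeonhole, more than `5 * ℓ` vertices cannot share a base.
    boundedProjection : Projection G H (5 * ℓ)
    boundedProjection = record
      { π     = base
      ; edges = base-edge
      ; fibre = λ g g-inj h const →
          let s , t , s<t , eq = Finₚ.pigeonhole ≤-refl (cell ∘ g)
          in Finₚ.<⇒≢ s<t (g-inj (cell-inj (trans (const s) (sym (const t))) eq))
      }

coneProjection : ∀ b G → NoIsolated G → ∀ H m ℓ →
  SubgraphOf (graph (cone b G)) ((H ⊠ Path (suc m)) ⊠ K ℓ) → Projection (cone b G) H (5 * ℓ)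
coneProjection b G nbr H m ℓ emb = boundedProjection zero radius
  where
  open ProductEmbedding (cone b G) H m ℓ emb
  radius : ∀ u → Within 2 (layer zero) (layer u)
  radius zero = within-refl 2 (layer zero)
  radius (suc u) with cone-radius b G nbr u
  ... | inj₁ e = let p , q = layer-edge {zero} {suc u} e in m≤n⇒m≤1+n p , m≤n⇒m≤1+n q
  ... | inj₂ (v , e , e′) =
        within-trans {1} {1} (layer-edge {zero} {v} e) (layer-edge {v} {suc u} e′)

-- With at least one apex the tower is a cone, whose apex serves as the root of radius 2.
towerProjection : ∀ N ℓ {r} (col : Fin r → Bool) → 1 ≤ r → ∀ {H m} →
  SubgraphOf (graph (tower (5 * ℓ) N col)) ((H ⊠ Path (suc m)) ⊠ K ℓ) →
  Projection (tower (5 * ℓ) N col) H (5 * ℓ)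
towerProjection N ℓ {suc r} col _ = coneProjection (col zero) _
  (copies-noIsolated (suc (5 * ℓ)) _ (tower-noIsolated (5 * ℓ) N (col ∘ suc))) _ _ ℓ

-- Choice of parameters and conclusion.

bipartite : ∀ G → Bipartite (graph G)
bipartite G = colour G , λ u v e → diffB⇒≢ (proper G u v e)

theorem11 : (i j k ℓ n : ℕ) → 1 ≤ k → 1 ≤ ℓ → 1 ≤ n → i + j ≡ k →
    Σ Graph (λ G → Bipartite G × PathwidthAtMost G (suc k) ×
    ((H : Graph) (m : ℕ) → SubgraphOf G ((H ⊠ Path (suc m)) ⊠ K ℓ) →
    SmallMinor 2 (Path n ⊕ Kbip i j) H))
theorem11 i j _ ℓ n 1≤k _ _ refl = graph T , bipartite T , tower-pathwidth c N col ,
  λ H m emb → let P = towerProjection N ℓ col 1≤k emb in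
    skeleton⇒minor {i = i} {j} P (tower-skeleton c n col P)
  where
  -- `c` is the bound on the fibres over H, and `N` the walk length that forces the `n * 2` edges
  -- needed for `n` rungs.
  c = 5 * ℓ
  N = enoughSteps c (n * 2)
  col = inFirst i {j}
  T = tower c N col
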